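{- Let $p$ be a prime. Every cusp for $R(p)$ is $R(p)$-equivalent to $\infty$.
   Context: $R(p)\subset\mathrm{SL}_2(\mathbb R)$ is the group of determinant-one matrices of the form $\begin{pmatrix} a & b\sqrt p\\ c\sqrt p & d\end{pmatrix}$ or $\begin{pmatrix} a\sqrt p & b\\ c & d\sqrt p\end{pmatrix}$ with $a,b,c,d\in\mathbb Z$, acting on $\mathbb H\cup\mathbb R\cup\{\infty\}$ by linear fractional transformations. A cusp for $R(p)$ is a point of $\mathbb R\cup\{\infty\}$ stabilized by a parabolic element of $R(p)$, i.e. an element different from $\pm I$ with trace $\pm2$. -}

module Defs where

open import Data.Nat.Base as ℕ using (ℕ; zero; suc)
import Data.Nat.Properties as ℕ
import Data.Nat.Tactic.RingSolver as ℕ-Ring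
open import Data.Integer.Base as ℤ using (ℤ; +_; -[1+_])
import Data.Integer.Properties as ℤ
open import Data.Rational.Base as ℚ using (ℚ; 0ℚ; 1ℚ; ½; ∣_∣)
import Data.Rational.Properties as ℚ
import Data.Rational.Unnormalised.Base as ℚᵘ
import Data.Rational.Unnormalised.Properties as ℚᵘ
open import Data.Rational.Solver using (module +-*-Solver)
open import Data.Product.Base using (Σ; ∃; ∃-syntax; _×_; _,_; proj₁; proj₂)
open import Data.Sum.Base using (_⊎_; inj₁; inj₂)
open import Relation.Nullary using (¬_; yes; no)
open import Relation.Binary.PropositionalEquality
  using (_≡_; refl; sym; trans; cong; cong₂; subst; subst₂)

-- The real numbers: Cauchy sequences of rationals, taken with the
-- equivalence _≃_ (the difference tends to 0) as their equality.
IsCauchy : (ℕ → ℚ) → Set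
IsCauchy x = ∀ ε → 0ℚ ℚ.< ε →
  ∃[ N ] ∀ m n → N ℕ.≤ m → N ℕ.≤ n → ∣ x m ℚ.- x n ∣ ℚ.< ε

record ℝ : Set where
  constructor mkℝ
  field
    seq    : ℕ → ℚ
    cauchy : IsCauchy seq

open ℝ public

infix 4 _≃_

_≃_ : ℝ → ℝ → Set
x ≃ y = ∀ ε → 0ℚ ℚ.< ε →
  ∃[ N ] ∀ n → N ℕ.≤ n → ∣ seq x n ℚ.- seq y n ∣ ℚ.< ε

half>0 : ∀ {ε} → 0ℚ ℚ.< ε → 0ℚ ℚ.< ½ ℚ.* ε
half>0 {ε} ε>0 =
  subst (ℚ._< ½ ℚ.* ε) (ℚ.*-zeroʳ ½) (ℚ.*-monoʳ-<-pos ½ ε>0)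

half+half : ∀ ε → ½ ℚ.* ε ℚ.+ ½ ℚ.* ε ≡ ε
half+half ε = trans (sym (ℚ.*-distribʳ-+ ε ½ ½)) (ℚ.*-identityˡ ε)

+-cauchy : ∀ x y → IsCauchy x → IsCauchy y → IsCauchy (λ n → x n ℚ.+ y n)
+-cauchy x y cx cy ε ε>0
  with cx (½ ℚ.* ε) (half>0 ε>0) | cy (½ ℚ.* ε) (half>0 ε>0)
... | M , p | N , q = M ℕ.⊔ N , λ m n hm hn → begin-strict
    ∣ (x m ℚ.+ y m) ℚ.- (x n ℚ.+ y n) ∣
      ≡⟨ cong ∣_∣ (solve 4 (λ a b c d → (a :+ b) :- (c :+ d) := (a :- c) :+ (b :- d))
                    refl (x m) (y m) (x n) (y n)) ⟩
    ∣ (x m ℚ.- x n) ℚ.+ (y m ℚ.- y n) ∣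
      ≤⟨ ℚ.∣p+q∣≤∣p∣+∣q∣ (x m ℚ.- x n) (y m ℚ.- y n) ⟩
    ∣ x m ℚ.- x n ∣ ℚ.+ ∣ y m ℚ.- y n ∣
      <⟨ ℚ.+-mono-< (p m n (ℕ.m⊔n≤o⇒m≤o M N hm) (ℕ.m⊔n≤o⇒m≤o M N hn))
                    (q m n (ℕ.m⊔n≤o⇒n≤o M N hm) (ℕ.m⊔n≤o⇒n≤o M N hn)) ⟩
    ½ ℚ.* ε ℚ.+ ½ ℚ.* ε
      ≡⟨ half+half ε ⟩
    ε ∎
  where
  open ℚ.≤-Reasoning
  open +-*-Solver

-‿cauchy : ∀ x → IsCauchy x → IsCauchy (λ n → ℚ.- x n)
-‿cauchy x cx ε ε>0 with cx ε ε>0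
... | N , p = N , λ m n hm hn → subst (ℚ._< ε) (sym (eq m n)) (p m n hm hn)
  where
  open +-*-Solver
  eq : ∀ m n → ∣ ℚ.- x m ℚ.- ℚ.- x n ∣ ≡ ∣ x m ℚ.- x n ∣
  eq m n = trans
    (cong ∣_∣ (solve 2 (λ a b → (:- a) :- (:- b) := :- (a :- b)) refl (x m) (x n)))
    (ℚ.∣-p∣≡∣p∣ (x m ℚ.- x n))

cauchy⇒bounded : ∀ x → IsCauchy x →
  ∃[ N ] ∃[ B ] (0ℚ ℚ.< B × ∀ n → N ℕ.≤ n → ∣ x n ∣ ℚ.≤ B)
cauchy⇒bounded x cx with cx 1ℚ (ℚ.positive⁻¹ 1ℚ)
... | N , p = N , 1ℚ ℚ.+ ∣ x N ∣ , pos , bound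
  where
  open ℚ.≤-Reasoning
  open +-*-Solver
  pos : 0ℚ ℚ.< 1ℚ ℚ.+ ∣ x N ∣
  pos = ℚ.+-mono-<-≤ (ℚ.positive⁻¹ 1ℚ) (ℚ.0≤∣p∣ (x N))
  bound : ∀ n → N ℕ.≤ n → ∣ x n ∣ ℚ.≤ 1ℚ ℚ.+ ∣ x N ∣
  bound n hn = begin
    ∣ x n ∣
      ≡⟨ cong ∣_∣ (solve 2 (λ a b → a := (a :- b) :+ b) refl (x n) (x N)) ⟩
    ∣ (x n ℚ.- x N) ℚ.+ x N ∣
      ≤⟨ ℚ.∣p+q∣≤∣p∣+∣q∣ (x n ℚ.- x N) (x N) ⟩
    ∣ x n ℚ.- x N ∣ ℚ.+ ∣ x N ∣
      ≤⟨ ℚ.+-monoˡ-≤ ∣ x N ∣ (ℚ.<⇒≤ (p n N hn ℕ.≤-refl)) ⟩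
    1ℚ ℚ.+ ∣ x N ∣ ∎

shrink : ∀ B ε → 0ℚ ℚ.< B → 0ℚ ℚ.< ε → ∃[ δ ] (0ℚ ℚ.< δ × B ℚ.* δ ≡ ε)
shrink B ε B>0 ε>0 = 1/B ℚ.* ε , ℚ.positive⁻¹ _ {{δ>0}} , eq
  where
  instance
    posB : ℚ.Positive B
    posB = ℚ.positive B>0
    nzB : ℚ.NonZero B
    nzB = ℚ.pos⇒nonZero B
  1/B = ℚ.1/ B
  δ>0 : ℚ.Positive (1/B ℚ.* ε)
  δ>0 = ℚ.pos*pos⇒pos 1/B {{ℚ.1/pos⇒pos B}} ε {{ℚ.positive ε>0}}
  eq : B ℚ.* (1/B ℚ.* ε) ≡ ε
  eq = trans (sym (ℚ.*-assoc B 1/B ε))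
             (trans (cong (ℚ._* ε) (ℚ.*-inverseʳ B)) (ℚ.*-identityˡ ε))

∣*∣≤ : ∀ a b A B → ∣ a ∣ ℚ.≤ A → ∣ b ∣ ℚ.≤ B → 0ℚ ℚ.≤ A →
       ∣ a ℚ.* b ∣ ℚ.≤ A ℚ.* B
∣*∣≤ a b A B p q A≥0 = begin
    ∣ a ℚ.* b ∣        ≡⟨ ℚ.∣p*q∣≡∣p∣*∣q∣ a b ⟩
    ∣ a ∣ ℚ.* ∣ b ∣    ≤⟨ ℚ.*-monoʳ-≤-nonNeg ∣ b ∣ {{ℚ.∣-∣-nonNeg b}} p ⟩
    A ℚ.* ∣ b ∣        ≤⟨ ℚ.*-monoˡ-≤-nonNeg A {{ℚ.nonNegative A≥0}} q ⟩
    A ℚ.* B            ∎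
  where open ℚ.≤-Reasoning

split-*-difference : ∀ a b c d →
  a ℚ.* b ℚ.- c ℚ.* d ≡ a ℚ.* (b ℚ.- d) ℚ.+ d ℚ.* (a ℚ.- c)
split-*-difference =
  solve 4 (λ a b c d → a :* b :- c :* d := a :* (b :- d) :+ d :* (a :- c)) refl
  where open +-*-Solver

*-difference-≤ : ∀ a b c d A B δ → 0ℚ ℚ.< A → 0ℚ ℚ.< B →
  ∣ a ∣ ℚ.≤ A → ∣ d ∣ ℚ.≤ B → ∣ b ℚ.- d ∣ ℚ.< δ → ∣ a ℚ.- c ∣ ℚ.< δ →
  ∣ a ℚ.* b ℚ.- c ℚ.* d ∣ ℚ.≤ (A ℚ.+ B) ℚ.* δ
*-difference-≤ a b c d A B δ A>0 B>0 hA hB q p = begin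
    ∣ a ℚ.* b ℚ.- c ℚ.* d ∣
      ≡⟨ cong ∣_∣ (split-*-difference a b c d) ⟩
    ∣ a ℚ.* (b ℚ.- d) ℚ.+ d ℚ.* (a ℚ.- c) ∣
      ≤⟨ ℚ.∣p+q∣≤∣p∣+∣q∣ (a ℚ.* (b ℚ.- d)) (d ℚ.* (a ℚ.- c)) ⟩
    ∣ a ℚ.* (b ℚ.- d) ∣ ℚ.+ ∣ d ℚ.* (a ℚ.- c) ∣
      ≤⟨ ℚ.+-mono-≤ (∣*∣≤ a (b ℚ.- d) A δ hA (ℚ.<⇒≤ q) (ℚ.<⇒≤ A>0))
                    (∣*∣≤ d (a ℚ.- c) B δ hB (ℚ.<⇒≤ p) (ℚ.<⇒≤ B>0)) ⟩
    A ℚ.* δ ℚ.+ B ℚ.* δ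
      ≡⟨ sym (ℚ.*-distribʳ-+ δ A B) ⟩
    (A ℚ.+ B) ℚ.* δ ∎
  where open ℚ.≤-Reasoning

half< : ∀ ε → 0ℚ ℚ.< ε → ½ ℚ.* ε ℚ.< ε
half< ε ε>0 = subst (½ ℚ.* ε ℚ.<_) (ℚ.*-identityˡ ε)
  (ℚ.*-monoˡ-<-pos ε {{ℚ.positive ε>0}} {½} {1ℚ} (ℚ.*<* (ℤ.+<+ (ℕ.s≤s (ℕ.s≤s ℕ.z≤n)))))

*-cauchy : ∀ x y → IsCauchy x → IsCauchy y → IsCauchy (λ n → x n ℚ.* y n)
*-cauchy x y cx cy ε ε>0 =
  let (K , A , A>0 , hA) = cauchy⇒bounded x cx
      (L , B , B>0 , hB) = cauchy⇒bounded y cy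
      (δ , δ>0 , eqδ)    = shrink (A ℚ.+ B) (½ ℚ.* ε) (ℚ.+-mono-< A>0 B>0) (half>0 ε>0)
      (M , p)            = cx δ δ>0
      (N , q)            = cy δ δ>0
      J = (K ℕ.⊔ L) ℕ.⊔ (M ℕ.⊔ N)
      KL≤ : ∀ {m} → J ℕ.≤ m → K ℕ.⊔ L ℕ.≤ m
      KL≤ = ℕ.m⊔n≤o⇒m≤o (K ℕ.⊔ L) (M ℕ.⊔ N)
      MN≤ : ∀ {m} → J ℕ.≤ m → M ℕ.⊔ N ℕ.≤ m
      MN≤ = ℕ.m⊔n≤o⇒n≤o (K ℕ.⊔ L) (M ℕ.⊔ N)
  in J , λ m n hm hn →
    ℚ.≤-<-trans
      (*-difference-≤ (x m) (y m) (x n) (y n) A B δ A>0 B>0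
        (hA m (ℕ.m⊔n≤o⇒m≤o K L (KL≤ hm)))
        (hB n (ℕ.m⊔n≤o⇒n≤o K L (KL≤ hn)))
        (q m n (ℕ.m⊔n≤o⇒n≤o M N (MN≤ hm)) (ℕ.m⊔n≤o⇒n≤o M N (MN≤ hn)))
        (p m n (ℕ.m⊔n≤o⇒m≤o M N (MN≤ hm)) (ℕ.m⊔n≤o⇒m≤o M N (MN≤ hn))))
      (subst (ℚ._< ε) (sym eqδ) (half< ε ε>0))

infixl 6 _+_
infixl 7 _*_
infix  8 -_

_+_ : ℝ → ℝ → ℝ
x + y = mkℝ (λ n → seq x n ℚ.+ seq y n) (+-cauchy (seq x) (seq y) (cauchy x) (cauchy y))

_*_ : ℝ → ℝ → ℝ
x * y = mkℝ (λ n → seq x n ℚ.* seq y n) (*-cauchy (seq x) (seq y) (cauchy x) (cauchy y))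

-_ : ℝ → ℝ
- x = mkℝ (λ n → ℚ.- seq x n) (-‿cauchy (seq x) (cauchy x))

fromℚ : ℚ → ℝ
fromℚ q = mkℝ (λ _ → q)
  (λ ε ε>0 → 0 , λ _ _ _ _ →
    subst (ℚ._< ε) (sym (cong ∣_∣ (ℚ.+-inverseʳ q))) ε>0)

fromℤ : ℤ → ℝ
fromℤ z = fromℚ (z ℚ./ 1)

0ℝ 1ℝ 2ℝ : ℝ
0ℝ = fromℤ (+ 0)
1ℝ = fromℤ (+ 1)
2ℝ = fromℤ (+ 2)

-- ⌊√ n ⌋ is the largest r with r * r ≤ n.
⌊√_⌋ : ℕ → ℕ
⌊√ zero ⌋  = 0
⌊√ suc n ⌋ with suc ⌊√ n ⌋ ℕ.* suc ⌊√ n ⌋ ℕ.≤? suc n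
... | yes _ = suc ⌊√ n ⌋
... | no  _ = ⌊√ n ⌋

⌊√⌋-lower : ∀ n → ⌊√ n ⌋ ℕ.* ⌊√ n ⌋ ℕ.≤ n
⌊√⌋-lower zero = ℕ.z≤n
⌊√⌋-lower (suc n) with suc ⌊√ n ⌋ ℕ.* suc ⌊√ n ⌋ ℕ.≤? suc n
... | yes p = p
... | no  _ = ℕ.m≤n⇒m≤1+n (⌊√⌋-lower n)

⌊√⌋-upper : ∀ n → n ℕ.< suc ⌊√ n ⌋ ℕ.* suc ⌊√ n ⌋
⌊√⌋-upper zero = ℕ.s≤s ℕ.z≤n
⌊√⌋-upper (suc n) with suc ⌊√ n ⌋ ℕ.* suc ⌊√ n ⌋ ℕ.≤? suc n
... | yes _ = ℕ.≤-<-trans (⌊√⌋-upper n)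
                (ℕ.*-mono-< (ℕ.n<1+n (suc ⌊√ n ⌋)) (ℕ.n<1+n (suc ⌊√ n ⌋)))
... | no ¬p = ℕ.≰⇒> ¬p

-- The n-th term is ⌊(n + 1)√k⌋ / (n + 1).
√-seq : ℕ → ℕ → ℚ
√-seq k n = + ⌊√ k ℕ.* (suc n ℕ.* suc n) ⌋ ℚ./ suc n

square-cancel-< : ∀ a b → a ℕ.* a ℕ.< b ℕ.* b → a ℕ.< b
square-cancel-< a b h = ℕ.≰⇒> (λ b≤a → ℕ.<⇒≱ h (ℕ.*-mono-≤ b≤a b≤a))

floor-compare : ∀ k m n →
  ⌊√ k ℕ.* (suc m ℕ.* suc m) ⌋ ℕ.* suc n ℕ.<
  suc ⌊√ k ℕ.* (suc n ℕ.* suc n) ⌋ ℕ.* suc m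
floor-compare k m n = square-cancel-< (r ℕ.* M) (suc s ℕ.* N) (begin-strict
    (r ℕ.* M) ℕ.* (r ℕ.* M)          ≡⟨ swap r M ⟩
    (r ℕ.* r) ℕ.* (M ℕ.* M)          ≤⟨ ℕ.*-monoˡ-≤ (M ℕ.* M) (⌊√⌋-lower (k ℕ.* (N ℕ.* N))) ⟩
    (k ℕ.* (N ℕ.* N)) ℕ.* (M ℕ.* M)  ≡⟨ swap′ k N M ⟩
    (k ℕ.* (M ℕ.* M)) ℕ.* (N ℕ.* N)  <⟨ ℕ.*-monoˡ-< (N ℕ.* N) (⌊√⌋-upper (k ℕ.* (M ℕ.* M))) ⟩
    (suc s ℕ.* suc s) ℕ.* (N ℕ.* N)  ≡⟨ sym (swap (suc s) N) ⟩
    (suc s ℕ.* N) ℕ.* (suc s ℕ.* N)  ∎)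
  where
  open ℕ.≤-Reasoning
  N = suc m
  M = suc n
  r = ⌊√ k ℕ.* (N ℕ.* N) ⌋
  s = ⌊√ k ℕ.* (M ℕ.* M) ⌋
  swap : ∀ a b → (a ℕ.* b) ℕ.* (a ℕ.* b) ≡ (a ℕ.* a) ℕ.* (b ℕ.* b)
  swap = ℕ-Ring.solve-∀
  swap′ : ∀ a b c → (a ℕ.* (b ℕ.* b)) ℕ.* (c ℕ.* c) ≡ (a ℕ.* (c ℕ.* c)) ℕ.* (b ℕ.* b)
  swap′ = ℕ-Ring.solve-∀

/-mono-< : ∀ a b m n → a ℕ.* suc n ℕ.< b ℕ.* suc m → + a ℚ./ suc m ℚ.< + b ℚ./ suc n
/-mono-< a b m n h = ℚ.toℚᵘ-cancel-< (ℚᵘ.<-respˡ-≃ (ℚᵘ.≃-sym (ℚ.toℚᵘ-fromℚᵘ (ℚᵘ.mkℚᵘ (+ a) m)))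
  (ℚᵘ.<-respʳ-≃ (ℚᵘ.≃-sym (ℚ.toℚᵘ-fromℚᵘ (ℚᵘ.mkℚᵘ (+ b) n)))
    (ℚᵘ.*<* (subst₂ ℤ._<_ (ℤ.pos-* a (suc n)) (ℤ.pos-* b (suc m)) (ℤ.+<+ h)))))

suc-/ : ∀ a n → + suc a ℚ./ suc n ≡ + a ℚ./ suc n ℚ.+ + 1 ℚ./ suc n
suc-/ a n = ℚ.toℚᵘ-injective (begin
    ℚ.toℚᵘ (+ suc a ℚ./ suc n)
      ≈⟨ ℚ.toℚᵘ-fromℚᵘ (ℚᵘ.mkℚᵘ (+ suc a) n) ⟩
    ℚᵘ.mkℚᵘ (+ suc a) n
      ≈⟨ ℚᵘ.*≡* (trans (sym (ℤ.pos-* (suc a) (suc n ℕ.* suc n)))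
           (trans (cong +_ (eq a (suc n)))
           (trans (ℤ.pos-* (a ℕ.* suc n ℕ.+ 1 ℕ.* suc n) (suc n))
             (cong (ℤ._* + suc n) (cong₂ ℤ._+_ (ℤ.pos-* a (suc n)) (ℤ.pos-* 1 (suc n))))))) ⟩
    ℚᵘ.mkℚᵘ (+ a) n ℚᵘ.+ ℚᵘ.mkℚᵘ (+ 1) n
      ≈⟨ ℚᵘ.≃-sym (ℚᵘ.+-cong (ℚ.toℚᵘ-fromℚᵘ (ℚᵘ.mkℚᵘ (+ a) n)) (ℚ.toℚᵘ-fromℚᵘ (ℚᵘ.mkℚᵘ (+ 1) n))) ⟩
    ℚ.toℚᵘ (+ a ℚ./ suc n) ℚᵘ.+ ℚ.toℚᵘ (+ 1 ℚ./ suc n)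
      ≈⟨ ℚᵘ.≃-sym (ℚ.toℚᵘ-homo-+ (+ a ℚ./ suc n) (+ 1 ℚ./ suc n)) ⟩
    ℚ.toℚᵘ (+ a ℚ./ suc n ℚ.+ + 1 ℚ./ suc n) ∎)
  where
  open ℚᵘ.≃-Reasoning
  eq : ∀ a k → suc a ℕ.* (k ℕ.* k) ≡ (a ℕ.* k ℕ.+ 1 ℕ.* k) ℕ.* k
  eq = ℕ-Ring.solve-∀

archimedean : ∀ ε → 0ℚ ℚ.< ε → ∃[ N ] ∀ n → N ℕ.≤ n → + 1 ℚ./ suc n ℚ.< ε
archimedean ε@(ℚ.mkℚ (+ suc k) d _) _ = suc d , λ n h →
  subst (+ 1 ℚ./ suc n ℚ.<_) (ℚ.↥p/↧p≡p ε)
    (/-mono-< 1 (suc k) n d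
      (ℕ.<-≤-trans (ℕ.s≤s (subst (ℕ._≤ n) (sym (ℕ.*-identityˡ (suc d))) h))
                   (ℕ.m≤m+n (suc n) (k ℕ.* suc n))))
archimedean (ℚ.mkℚ (+ zero) d _) (ℚ.*<* (ℤ.+<+ ()))
archimedean (ℚ.mkℚ -[1+ _ ] d _) (ℚ.*<* ())

∣-∣< : ∀ a b ε → a ℚ.< b ℚ.+ ε → b ℚ.< a ℚ.+ ε → ∣ a ℚ.- b ∣ ℚ.< ε
∣-∣< a b ε p q with ℚ.∣p∣≡p∨∣p∣≡-p (a ℚ.- b)
... | inj₁ e = subst₂ ℚ._<_ (sym e)
    (solve 2 (λ x y → (x :+ y) :- x := y) refl b ε) (ℚ.+-monoˡ-< (ℚ.- b) p)
  where open +-*-Solver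
... | inj₂ e = subst₂ ℚ._<_
    (trans (solve 2 (λ x y → y :- x := :- (x :- y)) refl a b) (sym e))
    (solve 2 (λ x y → (x :+ y) :- x := y) refl a ε) (ℚ.+-monoˡ-< (ℚ.- a) q)
  where open +-*-Solver

√-cauchy : ∀ k → IsCauchy (√-seq k)
√-cauchy k ε ε>0 with archimedean ε ε>0
... | N , small = N , λ m n hm hn → ∣-∣< (√-seq k m) (√-seq k n) ε (step m n hn) (step n m hm)
  where
  open ℚ.≤-Reasoning
  fl : ℕ → ℕ
  fl n = ⌊√ k ℕ.* (suc n ℕ.* suc n) ⌋
  step : ∀ m n → N ℕ.≤ n → √-seq k m ℚ.< √-seq k n ℚ.+ ε
  step m n hn = begin-strict
    + fl m ℚ./ suc m                   <⟨ /-mono-< (fl m) (suc (fl n)) m n (floor-compare k m n) ⟩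
    + suc (fl n) ℚ./ suc n             ≡⟨ suc-/ (fl n) n ⟩
    √-seq k n ℚ.+ + 1 ℚ./ suc n        <⟨ ℚ.+-monoʳ-< (√-seq k n) (small n hn) ⟩
    √-seq k n ℚ.+ ε                    ∎

infix 9 √_

√_ : ℕ → ℝ
√ k = mkℝ (√-seq k) (√-cauchy k)

-- mat a b c d has rows (a , b) and (c , d).
record Mat : Set where
  constructor mat
  field
    a b c d : ℝ

infix 4 _≋_

_≋_ : Mat → Mat → Set
mat a b c d ≋ mat a′ b′ c′ d′ = a ≃ a′ × b ≃ b′ × c ≃ c′ × d ≃ d′

det : Mat → ℝ
det (mat a b c d) = a * d + - (b * c)

tr : Mat → ℝ
tr (mat a b c d) = a + d

I -I : Mat
I  = mat 1ℝ 0ℝ 0ℝ 1ℝ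
-I = mat (- 1ℝ) 0ℝ 0ℝ (- 1ℝ)

_∈SL₂ℝ : Mat → Set
M ∈SL₂ℝ = det M ≃ 1ℝ

infix 4 _∈R⟨_⟩

_∈R⟨_⟩ : Mat → ℕ → Set
M ∈R⟨ p ⟩ = M ∈SL₂ℝ ×
  ∃[ a ] ∃[ b ] ∃[ c ] ∃[ d ]
    ( M ≋ mat (fromℤ a)       (fromℤ b * √ p)
              (fromℤ c * √ p) (fromℤ d)
    ⊎ M ≋ mat (fromℤ a * √ p) (fromℤ b)
              (fromℤ c)       (fromℤ d * √ p) )

IsParabolic : Mat → Set
IsParabolic M = ¬ (M ≋ I) × ¬ (M ≋ -I) × (tr M ≃ 2ℝ ⊎ tr M ≃ - 2ℝ)

data ℝ∪∞ : Set where
  fin : ℝ → ℝ∪∞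
  ∞   : ℝ∪∞

infix 4 _·_↦_

-- M · z ↦ w is the graph of the action of M ∈ SL₂(ℝ): w = (a z + b) / (c z + d),
-- and w = a / c at z = ∞, with value ∞ when the denominator vanishes.
-- It is a relation because the vanishing of a real number is undecidable;
-- the quotients are expressed by clearing the nonzero denominator.
_·_↦_ : Mat → ℝ∪∞ → ℝ∪∞ → Set
mat a b c d · fin x ↦ fin y = ¬ (c * x + d ≃ 0ℝ) × y * (c * x + d) ≃ a * x + b
mat a b c d · fin x ↦ ∞     = c * x + d ≃ 0ℝ
mat a b c d · ∞     ↦ fin y = ¬ (c ≃ 0ℝ) × y * c ≃ a
mat a b c d · ∞     ↦ ∞     = c ≃ 0ℝ

IsCusp : ℕ → ℝ∪∞ → Set
IsCusp p z = ∃[ M ] (M ∈R⟨ p ⟩ × IsParabolic M × M · z ↦ z)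

Equivalent : ℕ → ℝ∪∞ → ℝ∪∞ → Set
Equivalent p z w = ∃[ M ] (M ∈R⟨ p ⟩ × M · z ↦ w)

-- If M ∈ SL₂(ℝ) has trace 2t with t = ±1 and fixes x, then c x + d is an
-- eigenvalue of M, hence equals t. For M of the first form this reads
-- c √p x = t − d =: e, where c ≠ 0 because otherwise M = ±I; the second form
-- cannot be parabolic, since (a + d)² p = 4 is impossible. Reduce e / c to lowest
-- terms. If p ∤ e then gcd (p c , e) = 1 and (c √p , −e) is the lower row of an
-- element of R(p) of the first form; if e = p e′ then gcd (c , p e′) = 1 and
-- (c , −e′ √p) is the lower row of one of the second form. Both rows send x to ∞.
module Submission where

open import Defs
open import Data.Nat.Base as ℕ using (ℕ; zero; suc)
import Data.Nat.Properties as ℕ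
open import Data.Nat.Divisibility using (divides)
open import Data.Nat.Induction using (<-wellFounded)
open import Data.Nat.Primality using (Prime; prime⇒irreducible; ¬prime[0]; ¬prime[1])
open import Data.Integer.Base as ℤ using (ℤ; +_; -[1+_]; 0ℤ; 1ℤ; -1ℤ)
import Data.Integer.Properties as ℤ
import Data.Integer.DivMod as ℤ
import Data.Integer.Solver as ℤ-Solver
open import Data.Rational.Base as ℚ using (ℚ; 0ℚ; 1ℚ; ½; ∣_∣)
import Data.Rational.Properties as ℚ
open import Data.Rational.Solver using (module +-*-Solver)
import Data.Rational.Unnormalised.Base as ℚᵘ
import Data.Rational.Unnormalised.Properties as ℚᵘ
open import Data.Product.Base using (∃-syntax; _×_; _,_)
open import Data.Sum.Base using (_⊎_; inj₁; inj₂; [_,_]′)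
open import Function.Base using (_∘_)
open import Induction.WellFounded using (Acc; acc)
open import Relation.Nullary using (¬_; yes; no; contradiction)
open import Relation.Binary.PropositionalEquality
  using (_≡_; _≢_; refl; sym; trans; cong; cong₂; subst; subst₂; module ≡-Reasoning)

-- Equality of real numbers and linear combinations of equations.

-- Unlike x ≃ y, which unfolds to a function space, x ≈ y determines x and y
-- when it is unified.
infix 4 _≈_

record _≈_ (x y : ℝ) : Set where
  constructor wrap
  field unwrap : x ≃ y

open _≈_

∣p-0∣≡∣p∣ : ∀ p → ∣ p ℚ.- 0ℚ ∣ ≡ ∣ p ∣
∣p-0∣≡∣p∣ p = cong ∣_∣ (ℚ.+-identityʳ p)

-- A consequence of the equations xᵢ ≈ yᵢ is proved by exhibiting the difference of
-- its sides as a linear combination k₁ ∙ e₁ ⊕ … ⊕ kₘ ∙ eₘ of the equations eᵢ: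
-- ≈-by then asks for a polynomial identity in ℚ, term by term.
infixr 7 _∙_
infixl 6 _⊕_

_∙_ : ∀ k {x y} → x ≈ y → k * (x + - y) ≈ 0ℝ
_∙_ k {x} {y} (wrap x≃y) = wrap λ ε ε>0 →
  let (K , B , B>0 , ∣k∣≤B) = cauchy⇒bounded (seq k) (cauchy k)
      (δ , δ>0 , B*δ≡½ε)    = shrink B (½ ℚ.* ε) B>0 (half>0 ε>0)
      (N , close)           = x≃y δ δ>0
  in K ℕ.⊔ N , λ n h → begin-strict
    ∣ seq k n ℚ.* (seq x n ℚ.- seq y n) ℚ.- 0ℚ ∣  ≡⟨ ∣p-0∣≡∣p∣ _ ⟩
    ∣ seq k n ℚ.* (seq x n ℚ.- seq y n) ∣
      ≤⟨ ∣*∣≤ (seq k n) _ B δ (∣k∣≤B n (ℕ.m⊔n≤o⇒m≤o K N h))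
           (ℚ.<⇒≤ (close n (ℕ.m⊔n≤o⇒n≤o K N h))) (ℚ.<⇒≤ B>0) ⟩
    B ℚ.* δ                                       ≡⟨ B*δ≡½ε ⟩
    ½ ℚ.* ε                                       <⟨ half< ε ε>0 ⟩
    ε                                             ∎
  where open ℚ.≤-Reasoning

_⊕_ : ∀ {x y} → x ≈ 0ℝ → y ≈ 0ℝ → x + y ≈ 0ℝ
_⊕_ {x} {y} (wrap x≃0) (wrap y≃0) = wrap λ ε ε>0 →
  let (M , p) = x≃0 (½ ℚ.* ε) (half>0 ε>0)
      (N , q) = y≃0 (½ ℚ.* ε) (half>0 ε>0)
  in M ℕ.⊔ N , λ n h → begin-strict
    ∣ seq x n ℚ.+ seq y n ℚ.- 0ℚ ∣           ≡⟨ ∣p-0∣≡∣p∣ _ ⟩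
    ∣ seq x n ℚ.+ seq y n ∣                  ≤⟨ ℚ.∣p+q∣≤∣p∣+∣q∣ (seq x n) (seq y n) ⟩
    ∣ seq x n ∣ ℚ.+ ∣ seq y n ∣
      ≡⟨ sym (cong₂ ℚ._+_ (∣p-0∣≡∣p∣ (seq x n)) (∣p-0∣≡∣p∣ (seq y n))) ⟩
    ∣ seq x n ℚ.- 0ℚ ∣ ℚ.+ ∣ seq y n ℚ.- 0ℚ ∣
      <⟨ ℚ.+-mono-< (p n (ℕ.m⊔n≤o⇒m≤o M N h)) (q n (ℕ.m⊔n≤o⇒n≤o M N h)) ⟩
    ½ ℚ.* ε ℚ.+ ½ ℚ.* ε                      ≡⟨ half+half ε ⟩
    ε                                        ∎
  where open ℚ.≤-Reasoning

≈-by : ∀ {x y z} → z ≈ 0ℝ → (∀ n → seq x n ℚ.- seq y n ≡ seq z n) → x ≈ y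
≈-by {x} {y} {z} (wrap z≃0) x-y≡z = wrap λ ε ε>0 →
  let (N , close) = z≃0 ε ε>0
  in N , λ n h → subst (ℚ._< ε)
       (trans (∣p-0∣≡∣p∣ (seq z n)) (cong ∣_∣ (sym (x-y≡z n)))) (close n h)

≈-pointwise : ∀ {x y} → (∀ n → seq x n ≡ seq y n) → x ≈ y
≈-pointwise {x} {y} x≡y = wrap λ ε ε>0 → 0 , λ n _ →
  subst (ℚ._< ε)
    (sym (cong ∣_∣ (trans (cong (ℚ._- seq y n) (x≡y n)) (ℚ.+-inverseʳ (seq y n))))) ε>0

≈-sym : ∀ {x y} → x ≈ y → y ≈ x
≈-sym {x} {y} x≈y = ≈-by ((- 1ℝ) ∙ x≈y) λ n →
  solve 2 (λ x y → y :- x := (:- con 1ℚ) :* (x :- y)) refl (seq x n) (seq y n)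
  where open +-*-Solver

≈-trans : ∀ {x y z} → x ≈ y → y ≈ z → x ≈ z
≈-trans {x} {y} {z} x≈y y≈z = ≈-by (1ℝ ∙ x≈y ⊕ 1ℝ ∙ y≈z) λ n →
  solve 3 (λ x y z → x :- z := con 1ℚ :* (x :- y) :+ con 1ℚ :* (y :- z)) refl
    (seq x n) (seq y n) (seq z n)
  where open +-*-Solver

-- A term of absolute value at least ε has a square of absolute value at least ε². Hence an index
-- from which the squares stay below ε² serves for `x` and ε.
x*x≈0⇒x≈0 : ∀ x → x * x ≈ 0ℝ → x ≈ 0ℝ
x*x≈0⇒x≈0 x (wrap x²≃0) = wrap λ ε ε>0 →
  let (N , close) = x²≃0 (ε ℚ.* ε) (ε²>0 ε>0)
  in N , λ n h → subst (ℚ._< ε) (sym (∣p-0∣≡∣p∣ (seq x n)))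
       (ℚ.≰⇒> λ ε≤∣x∣ → ℚ.<-irrefl refl (ℚ.<-≤-trans (close n h) (ε²≤ n ε>0 ε≤∣x∣)))
  where
  open ℚ.≤-Reasoning
  ε²>0 : ∀ {ε} → 0ℚ ℚ.< ε → 0ℚ ℚ.< ε ℚ.* ε
  ε²>0 {ε} ε>0 = ℚ.positive⁻¹ _ {{ℚ.pos*pos⇒pos ε {{ℚ.positive ε>0}} ε {{ℚ.positive ε>0}}}}
  ε²≤ : ∀ n {ε} → 0ℚ ℚ.< ε → ε ℚ.≤ ∣ seq x n ∣ → ε ℚ.* ε ℚ.≤ ∣ seq x n ℚ.* seq x n ℚ.- 0ℚ ∣
  ε²≤ n {ε} ε>0 ε≤∣x∣ = begin
    ε ℚ.* ε                            ≤⟨ ℚ.*-monoˡ-≤-nonNeg ε {{ℚ.nonNegative (ℚ.<⇒≤ ε>0)}} ε≤∣x∣ ⟩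
    ε ℚ.* ∣ seq x n ∣                  ≤⟨ ℚ.*-monoʳ-≤-nonNeg ∣ seq x n ∣ {{ℚ.∣-∣-nonNeg (seq x n)}} ε≤∣x∣ ⟩
    ∣ seq x n ∣ ℚ.* ∣ seq x n ∣        ≡⟨ sym (ℚ.∣p*q∣≡∣p∣*∣q∣ (seq x n) (seq x n)) ⟩
    ∣ seq x n ℚ.* seq x n ∣            ≡⟨ sym (∣p-0∣≡∣p∣ _) ⟩
    ∣ seq x n ℚ.* seq x n ℚ.- 0ℚ ∣     ∎

-- Rationals and integers inside ℝ.

-- Equality in ℚ is decidable. For distinct `p` and `q` the constant gap, itself taken as ε, would
-- have to be smaller than itself.
fromℚ-injective : ∀ {p q} → fromℚ p ≈ fromℚ q → p ≡ q
fromℚ-injective {p} {q} (wrap p≃q) with p ℚ.≟ q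
... | yes p≡q = p≡q
... | no  p≢q =
  let (N , close) = p≃q ∣ p ℚ.- q ∣ ∣p-q∣>0 in contradiction (close N ℕ.≤-refl) (ℚ.<-irrefl refl)
  where
  open import Algebra.Properties.Group ℚ.+-0-group using (x∙y⁻¹≈ε⇒x≈y)
  ∣p-q∣>0 : 0ℚ ℚ.< ∣ p ℚ.- q ∣
  ∣p-q∣>0 = ℚ.≰⇒> λ ∣p-q∣≤0 → p≢q (x∙y⁻¹≈ε⇒x≈y p q
    (ℚ.∣p∣≡0⇒p≡0 _ (ℚ.≤-antisym ∣p-q∣≤0 (ℚ.0≤∣p∣ _))))

-- Applying `toℚᵘ` moves the claim to `ℚᵘ`, where equality is cross-multiplication and no gcd has to
-- be computed.
fromℚᵘ-homo-* : ∀ p q → ℚ.fromℚᵘ (p ℚᵘ.* q) ≡ ℚ.fromℚᵘ p ℚ.* ℚ.fromℚᵘ q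
fromℚᵘ-homo-* p q = ℚ.toℚᵘ-injective (begin
  ℚ.toℚᵘ (ℚ.fromℚᵘ (p ℚᵘ.* q))                      ≈⟨ ℚ.toℚᵘ-fromℚᵘ (p ℚᵘ.* q) ⟩
  p ℚᵘ.* q
    ≈⟨ ℚᵘ.≃-sym (ℚᵘ.*-cong (ℚ.toℚᵘ-fromℚᵘ p) (ℚ.toℚᵘ-fromℚᵘ q)) ⟩
  ℚ.toℚᵘ (ℚ.fromℚᵘ p) ℚᵘ.* ℚ.toℚᵘ (ℚ.fromℚᵘ q)
    ≈⟨ ℚᵘ.≃-sym (ℚ.toℚᵘ-homo-* (ℚ.fromℚᵘ p) (ℚ.fromℚᵘ q)) ⟩
  ℚ.toℚᵘ (ℚ.fromℚᵘ p ℚ.* ℚ.fromℚᵘ q)                ∎)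
  where open ℚᵘ.≃-Reasoning

fromℚᵘ-homo-+ : ∀ p q → ℚ.fromℚᵘ (p ℚᵘ.+ q) ≡ ℚ.fromℚᵘ p ℚ.+ ℚ.fromℚᵘ q
fromℚᵘ-homo-+ p q = ℚ.toℚᵘ-injective (begin
  ℚ.toℚᵘ (ℚ.fromℚᵘ (p ℚᵘ.+ q))                      ≈⟨ ℚ.toℚᵘ-fromℚᵘ (p ℚᵘ.+ q) ⟩
  p ℚᵘ.+ q
    ≈⟨ ℚᵘ.≃-sym (ℚᵘ.+-cong (ℚ.toℚᵘ-fromℚᵘ p) (ℚ.toℚᵘ-fromℚᵘ q)) ⟩
  ℚ.toℚᵘ (ℚ.fromℚᵘ p) ℚᵘ.+ ℚ.toℚᵘ (ℚ.fromℚᵘ q)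
    ≈⟨ ℚᵘ.≃-sym (ℚ.toℚᵘ-homo-+ (ℚ.fromℚᵘ p) (ℚ.fromℚᵘ q)) ⟩
  ℚ.toℚᵘ (ℚ.fromℚᵘ p ℚ.+ ℚ.fromℚᵘ q)                ∎)
  where open ℚᵘ.≃-Reasoning

fromℚᵘ-mono-≤ : ∀ {p q} → p ℚᵘ.≤ q → ℚ.fromℚᵘ p ℚ.≤ ℚ.fromℚᵘ q
fromℚᵘ-mono-≤ {p} {q} p≤q = ℚ.toℚᵘ-cancel-≤
  (ℚᵘ.≤-respˡ-≃ (ℚᵘ.≃-sym (ℚ.toℚᵘ-fromℚᵘ p))
    (ℚᵘ.≤-respʳ-≃ (ℚᵘ.≃-sym (ℚ.toℚᵘ-fromℚᵘ q)) p≤q))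

fromℤ-* : ∀ m n → fromℤ (m ℤ.* n) ≈ fromℤ m * fromℤ n
fromℤ-* m n = ≈-pointwise λ _ → fromℚᵘ-homo-* (ℚᵘ.mkℚᵘ m 0) (ℚᵘ.mkℚᵘ n 0)

fromℤ-+ : ∀ m n → fromℤ (m ℤ.+ n) ≈ fromℤ m + fromℤ n
fromℤ-+ m n = ≈-pointwise λ _ → trans
  -- The unnormalised sum has numerator `m * 1 + n * 1`, so the factors 1 are put in first.
  (cong₂ (λ i j → (i ℤ.+ j) ℚ./ 1) (sym (ℤ.*-identityʳ m)) (sym (ℤ.*-identityʳ n)))
  (fromℚᵘ-homo-+ (ℚᵘ.mkℚᵘ m 0) (ℚᵘ.mkℚᵘ n 0))

fromℤ-injective : ∀ {m n} → fromℤ m ≈ fromℤ n → m ≡ n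
fromℤ-injective {m} {n} m≈n =
  trans (sym (ℤ.*-identityʳ m))
    (trans (ℚᵘ.drop-*≡* (ℚ./-injective-≃ (ℚᵘ.mkℚᵘ m 0) (ℚᵘ.mkℚᵘ n 0) (fromℚ-injective m≈n)))
      (ℤ.*-identityʳ n))

-- The reciprocal of a nonzero integer is a constant rational sequence, so multiplying by it takes
-- no inversion of a real number.
fromℤ-cancel : ∀ {m x} → m ≢ 0ℤ → fromℤ m * x ≈ 0ℝ → x ≈ 0ℝ
fromℤ-cancel {m} {x} m≢0 mx≈0 = ≈-by (fromℚ (ℚ.1/ q) ∙ mx≈0) λ n → begin
  seq x n ℚ.- 0ℚ                            ≡⟨ ℚ.+-identityʳ (seq x n) ⟩
  seq x n                                   ≡⟨ sym (ℚ.*-identityˡ (seq x n)) ⟩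
  1ℚ ℚ.* seq x n                            ≡⟨ cong (ℚ._* seq x n) (sym (ℚ.*-inverseˡ q)) ⟩
  ℚ.1/ q ℚ.* q ℚ.* seq x n                  ≡⟨ ℚ.*-assoc (ℚ.1/ q) q (seq x n) ⟩
  ℚ.1/ q ℚ.* (q ℚ.* seq x n)                ≡⟨ cong (ℚ.1/ q ℚ.*_) (sym (ℚ.+-identityʳ (q ℚ.* seq x n))) ⟩
  ℚ.1/ q ℚ.* (q ℚ.* seq x n ℚ.- 0ℚ)         ∎
  where
  open ≡-Reasoning
  q = m ℚ./ 1
  instance
    q≢0 : ℚ.NonZero q
    q≢0 = ℚ.≢-nonZero λ q≡0 → m≢0 (fromℤ-injective (≈-pointwise λ _ → q≡0))

-- The square of √k is k.

p≤q⇒0≤q-p : ∀ {p q} → p ℚ.≤ q → 0ℚ ℚ.≤ q ℚ.- p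
p≤q⇒0≤q-p {p} {q} p≤q = subst (ℚ._≤ q ℚ.- p) (ℚ.+-inverseʳ p) (ℚ.+-monoˡ-≤ (ℚ.- p) p≤q)

-- Term by term, the distance from `y` to `x` is at most the distance from `y` to `z`, which tends
-- to 0.
squeeze : ∀ {x y z} → y ≈ z → (∀ n → seq x n ℚ.≤ seq y n) → (∀ n → seq z n ℚ.≤ seq x n) → y ≈ x
squeeze {x} {y} {z} (wrap y≃z) x≤y z≤x = wrap λ ε ε>0 →
  let (N , close) = y≃z ε ε>0
  in N , λ n h → ℚ.≤-<-trans (gap-mono (z≤x n) (x≤y n)) (close n h)
  where
  open ℚ.≤-Reasoning
  gap-mono : ∀ {a b c} → a ℚ.≤ b → b ℚ.≤ c → ∣ c ℚ.- b ∣ ℚ.≤ ∣ c ℚ.- a ∣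
  gap-mono {a} {b} {c} a≤b b≤c = begin
    ∣ c ℚ.- b ∣    ≡⟨ ℚ.0≤p⇒∣p∣≡p (p≤q⇒0≤q-p b≤c) ⟩
    c ℚ.- b        ≤⟨ ℚ.+-monoʳ-≤ c (ℚ.neg-antimono-≤ a≤b) ⟩
    c ℚ.- a        ≡⟨ sym (ℚ.0≤p⇒∣p∣≡p (p≤q⇒0≤q-p (ℚ.≤-trans a≤b b≤c))) ⟩
    ∣ c ℚ.- a ∣    ∎

module _ (r : ℕ → ℚ) (r>0 : ∀ n → 0ℚ ℚ.< r n)
         (small : ∀ ε → 0ℚ ℚ.< ε → ∃[ N ] ∀ n → N ℕ.≤ n → r n ℚ.< ε) where

  -- Turns an error term such as 1/(n + 1) into a real number, so that its convergence to 0 can be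
  -- used as an equation in `≈-by`.
  positive-null-sequence : ℝ
  positive-null-sequence = mkℝ r λ ε ε>0 → let (N , r<ε) = small ε ε>0 in
    N , λ m n hm hn → ∣-∣< (r m) (r n) ε (step m n (r<ε m hm)) (step n m (r<ε n hn))
    where
    step : ∀ {ε} m n → r m ℚ.< ε → r m ℚ.< r n ℚ.+ ε
    step {ε} m n r<ε = subst (ℚ._< r n ℚ.+ ε) (ℚ.+-identityˡ (r m)) (ℚ.+-mono-< (r>0 n) r<ε)

  positive-null-sequence≈0 : positive-null-sequence ≈ 0ℝ
  positive-null-sequence≈0 = wrap λ ε ε>0 → let (N , r<ε) = small ε ε>0 in
    N , λ n h → subst (ℚ._< ε)
      (sym (trans (∣p-0∣≡∣p∣ (r n)) (ℚ.0≤p⇒∣p∣≡p (ℚ.<⇒≤ (r>0 n))))) (r<ε n h)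

perturb-square : ∀ x r → r ≈ 0ℝ → (x + r) * (x + r) ≈ x * x
perturb-square x r r≈0 = ≈-by ((x + x + r) ∙ r≈0) λ n →
  solve 2 (λ x r → (x :+ r) :* (x :+ r) :- x :* x := (x :+ x :+ r) :* (r :- con 0ℚ)) refl
    (seq x n) (seq r n)
  where open +-*-Solver

/-square : ∀ a n → (+ a ℚ./ suc n) ℚ.* (+ a ℚ./ suc n) ≡ + (a ℕ.* a) ℚ./ (suc n ℕ.* suc n)
/-square a n = trans (sym (fromℚᵘ-homo-* (ℚᵘ.mkℚᵘ (+ a) n) (ℚᵘ.mkℚᵘ (+ a) n)))
  (cong (λ i → i ℚ./ (suc n ℕ.* suc n)) (sym (ℤ.pos-* a a)))

√-seq-lower : ∀ k n → √-seq k n ℚ.* √-seq k n ℚ.≤ + k ℚ./ 1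
√-seq-lower k n = subst (ℚ._≤ + k ℚ./ 1) (sym (/-square f n))
  -- `mkℚᵘ` takes the denominator minus one: `suc n * suc n` is `suc (n + n * suc n)`.
  (fromℚᵘ-mono-≤ {ℚᵘ.mkℚᵘ (+ (f ℕ.* f)) (n ℕ.+ n ℕ.* suc n)} {ℚᵘ.mkℚᵘ (+ k) 0}
    (ℚᵘ.*≤* (subst₂ ℤ._≤_ (sym (ℤ.*-identityʳ (+ (f ℕ.* f)))) (ℤ.pos-* k (suc n ℕ.* suc n))
      (ℤ.+≤+ (⌊√⌋-lower (k ℕ.* (suc n ℕ.* suc n)))))))
  where f = ⌊√ k ℕ.* (suc n ℕ.* suc n) ⌋

√-seq-upper : ∀ k n →
  + k ℚ./ 1 ℚ.< (√-seq k n ℚ.+ + 1 ℚ./ suc n) ℚ.* (√-seq k n ℚ.+ + 1 ℚ./ suc n)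
√-seq-upper k n = subst (+ k ℚ./ 1 ℚ.<_)
  (trans (sym (/-square (suc f) n)) (cong (λ q → q ℚ.* q) (suc-/ f n)))
  (/-mono-< k (suc f ℕ.* suc f) 0 (n ℕ.+ n ℕ.* suc n)
    (subst (k ℕ.* (suc n ℕ.* suc n) ℕ.<_) (sym (ℕ.*-identityʳ (suc f ℕ.* suc f)))
      (⌊√⌋-upper (k ℕ.* (suc n ℕ.* suc n)))))
  where f = ⌊√ k ℕ.* (suc n ℕ.* suc n) ⌋

-- With f the integer square root of k(n + 1)², the bounds f² ≤ k(n + 1)² < (f + 1)² put k between
-- the squares of the n-th term and of that term plus 1/(n + 1). These two squares have the same
-- limit.
√*√≈ : ∀ k → √ k * √ k ≈ fromℤ (+ k)
√*√≈ k = ≈-trans (≈-sym above≈below)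
  (squeeze above≈below (λ n → ℚ.<⇒≤ (√-seq-upper k n)) (√-seq-lower k))
  where
  r>0 : ∀ n → 0ℚ ℚ.< + 1 ℚ./ suc n
  r>0 n = /-mono-< 0 1 0 n (ℕ.s≤s ℕ.z≤n)
  R : ℝ
  R = positive-null-sequence (λ n → + 1 ℚ./ suc n) r>0 archimedean
  above≈below : (√ k + R) * (√ k + R) ≈ √ k * √ k
  above≈below = perturb-square (√ k) R (positive-null-sequence≈0 _ r>0 archimedean)

-- Integer identities carried over to ℝ.

fromℤ-cong : ∀ {m n} → m ≡ n → fromℤ m ≈ fromℤ n
fromℤ-cong m≡n = ≈-pointwise λ _ → cong (ℚ._/ 1) m≡n

fromℤ-neg : ∀ m → fromℤ (ℤ.- m) ≈ - fromℤ m
fromℤ-neg m = ≈-by ((- 1ℝ) ∙ fromℤ-+ m (ℤ.- m) ⊕ 1ℝ ∙ fromℤ-cong (ℤ.+-inverseʳ m)) λ _ →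
  solve 3 (λ m m̅ s → m̅ :- (:- m) :=
    (:- con 1ℚ) :* (s :- (m :+ m̅)) :+ con 1ℚ :* (s :- con 0ℚ)) refl
    (m ℚ./ 1) ((ℤ.- m) ℚ./ 1) ((m ℤ.+ ℤ.- m) ℚ./ 1)
  where open +-*-Solver

-- Transfers a determinant-one condition, written without subtraction as ad = 1 + bc.
fromℤ-det : ∀ k l m n → k ℤ.* l ≡ 1ℤ ℤ.+ m ℤ.* n →
  fromℤ k * fromℤ l ≈ 1ℝ + fromℤ m * fromℤ n
fromℤ-det k l m n eq =
  ≈-by ((- 1ℝ) ∙ fromℤ-* k l ⊕ 1ℝ ∙ fromℤ-cong eq ⊕ 1ℝ ∙ fromℤ-+ 1ℤ (m ℤ.* n) ⊕ 1ℝ ∙ fromℤ-* m n) λ _ →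
    solve 7 (λ k l m n kl 1+mn mn → k :* l :- (con 1ℚ :+ m :* n) :=
      (:- con 1ℚ) :* (kl :- k :* l) :+ con 1ℚ :* (kl :- 1+mn) :+
      con 1ℚ :* (1+mn :- (con 1ℚ :+ mn)) :+ con 1ℚ :* (mn :- m :* n)) refl
      (k ℚ./ 1) (l ℚ./ 1) (m ℚ./ 1) (n ℚ./ 1)
      ((k ℤ.* l) ℚ./ 1) ((1ℤ ℤ.+ m ℤ.* n) ℚ./ 1) ((m ℤ.* n) ℚ./ 1)
  where open +-*-Solver

-- Bézout relations and primes.

-- `g` is a gcd up to sign. The relation is stated for the cofactors, since these form the reduced
-- fraction and become the lower row of a matrix.
record Bézout (a b : ℤ) : Set where
  field
    g a′ b′ u v : ℤ
    g≢0         : g ≢ 0ℤ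
    a≡ga′       : a ≡ g ℤ.* a′
    b≡gb′       : b ≡ g ℤ.* b′
    ua′+vb′≡1   : u ℤ.* a′ ℤ.+ v ℤ.* b′ ≡ 1ℤ

-- Euclid's algorithm, by recursion on the absolute value of `b`. The hypothesis excludes the pair
-- (0, 0), which makes the final `g` nonzero. It persists because the next first argument is the
-- nonzero `b`.
bézout : ∀ a b → (b ≡ 0ℤ → a ≢ 0ℤ) → Bézout a b
bézout a b nonzero = go a b nonzero (<-wellFounded ℤ.∣ b ∣)
  where
  open ℤ-Solver.+-*-Solver
  go : ∀ a b → (b ≡ 0ℤ → a ≢ 0ℤ) → Acc ℕ._<_ ℤ.∣ b ∣ → Bézout a b
  go a b nonzero (acc smaller) with b ℤ.≟ 0ℤ
  ... | yes b≡0 = record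
    { g = a ; a′ = 1ℤ ; b′ = 0ℤ ; u = 1ℤ ; v = 0ℤ
    ; g≢0       = nonzero b≡0
    ; a≡ga′     = sym (ℤ.*-identityʳ a)
    ; b≡gb′     = trans b≡0 (sym (ℤ.*-zeroʳ a))
    ; ua′+vb′≡1 = refl
    }
  ... | no b≢0 = record
    -- The recursive call gives b = g a′, r = g b′ and u a′ + v b′ = 1 for the remainder r.
    -- Substituting into a = r + q b gives a = g (b′ + q a′), and v (b′ + q a′) + (u - q v) a′ = 1.
    { g = g ; a′ = b′ ℤ.+ q ℤ.* a′ ; b′ = a′ ; u = v ; v = u ℤ.- q ℤ.* v
    ; g≢0       = g≢0
    ; a≡ga′     = trans (ℤ.a≡a%n+[a/n]*n a b)
        (trans (cong₂ (λ r b → r ℤ.+ q ℤ.* b) b≡gb′ a≡ga′)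
          (solve 4 (λ g r b q → g :* r :+ q :* (g :* b) := g :* (r :+ q :* b)) refl g b′ a′ q))
    ; b≡gb′     = a≡ga′
    ; ua′+vb′≡1 = trans
        (solve 5 (λ u v q r b → v :* (r :+ q :* b) :+ (u :- q :* v) :* b := u :* b :+ v :* r)
          refl u v q b′ a′)
        ua′+vb′≡1
    }
    where
    instance
      b-nonZero : ℤ.NonZero b
      b-nonZero = ℤ.≢-nonZero b≢0
    q = a ℤ./ b
    open Bézout (go b (+ (a ℤ.% b)) (λ _ → b≢0) (smaller (ℤ.n%d<d a b)))

∣i∣≡1⇒i*i≡1 : ∀ i → ℤ.∣ i ∣ ≡ 1 → i ℤ.* i ≡ 1ℤ
∣i∣≡1⇒i*i≡1 (+ 1)      refl = refl
∣i∣≡1⇒i*i≡1 -[1+ 0 ]   refl = refl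

∣i∣≡n⇒n∣i*j : ∀ {n} i j → ℤ.∣ i ∣ ≡ n → ∃[ k ] i ℤ.* j ≡ + n ℤ.* k
∣i∣≡n⇒n∣i*j (+ n)      j refl = j , refl
∣i∣≡n⇒n∣i*j (-[1+ n ]) j refl = ℤ.- j ,
  solve 2 (λ i j → (:- i) :* j := i :* (:- j)) refl (+ suc n) j
  where open ℤ-Solver.+-*-Solver

-- The gcd `g` of p and e divides the prime p, so its absolute value is 1 or p. In the first case
-- the cofactor relation is multiplied by g² = 1, which covers both signs of `g`; in the second p
-- divides e = g b′.
prime-coprime-or-divides : ∀ {p} → Prime p → ∀ e →
  (∃[ r ] ∃[ s ] r ℤ.* + p ℤ.+ s ℤ.* e ≡ 1ℤ) ⊎ (∃[ e′ ] e ≡ + p ℤ.* e′)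
prime-coprime-or-divides {zero}  pr e = contradiction pr ¬prime[0]
prime-coprime-or-divides {p@(suc _)} pr e =
  [ inj₁ ∘ coprime , inj₂ ∘ divisible ]′ (prime⇒irreducible pr (divides ℤ.∣ a′ ∣ p≡∣a′∣*∣g∣))
  where
  open Bézout (bézout (+ p) e (λ _ ()))
  open ≡-Reasoning
  open ℤ-Solver.+-*-Solver
  p≡∣a′∣*∣g∣ : p ≡ ℤ.∣ a′ ∣ ℕ.* ℤ.∣ g ∣
  p≡∣a′∣*∣g∣ = trans (cong ℤ.∣_∣ a≡ga′) (trans (ℤ.abs-* g a′) (ℕ.*-comm ℤ.∣ g ∣ ℤ.∣ a′ ∣))
  coprime : ℤ.∣ g ∣ ≡ 1 → ∃[ r ] ∃[ s ] r ℤ.* + p ℤ.+ s ℤ.* e ≡ 1ℤ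
  coprime ∣g∣≡1 = g ℤ.* u , g ℤ.* v , (begin
    g ℤ.* u ℤ.* + p ℤ.+ g ℤ.* v ℤ.* e
      ≡⟨ cong₂ (λ p e → g ℤ.* u ℤ.* p ℤ.+ g ℤ.* v ℤ.* e) a≡ga′ b≡gb′ ⟩
    g ℤ.* u ℤ.* (g ℤ.* a′) ℤ.+ g ℤ.* v ℤ.* (g ℤ.* b′)
      ≡⟨ solve 5 (λ g u v a b → g :* u :* (g :* a) :+ g :* v :* (g :* b) :=
           (g :* g) :* (u :* a :+ v :* b)) refl g u v a′ b′ ⟩
    (g ℤ.* g) ℤ.* (u ℤ.* a′ ℤ.+ v ℤ.* b′)
      ≡⟨ cong₂ ℤ._*_ (∣i∣≡1⇒i*i≡1 g ∣g∣≡1) ua′+vb′≡1 ⟩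
    1ℤ ∎)
  divisible : ℤ.∣ g ∣ ≡ p → ∃[ e′ ] e ≡ + p ℤ.* e′
  divisible ∣g∣≡p = let (k , gb′≡pk) = ∣i∣≡n⇒n∣i*j g b′ ∣g∣≡p in k , trans b≡gb′ gb′≡pk

-- The values n = 1 and n = 2 would force p = 4 and p = 1, and n ≥ 3 makes the product at least 9.
prime∧n*n*p≢4 : ∀ {p} → Prime p → ∀ n → n ℕ.* n ℕ.* p ≢ 4
prime∧n*n*p≢4 pr 0 ()
prime∧n*n*p≢4 {p} pr 1 eq =
  contradiction (subst Prime (trans (sym (ℕ.*-identityˡ p)) eq) pr) (λ pr → ¬prime[4] pr)
  where
  ¬prime[4] : ¬ Prime 4
  ¬prime[4] pr with prime⇒irreducible pr (divides {2} 2 refl)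
  ... | inj₁ ()
  ... | inj₂ ()
prime∧n*n*p≢4 {p} pr 2 eq = ¬prime[1] (subst Prime (ℕ.*-cancelˡ-≡ p 1 4 eq) pr)
prime∧n*n*p≢4 {zero} pr (suc (suc (suc n))) eq = ¬prime[0] pr
prime∧n*n*p≢4 {suc p} pr n@(suc (suc (suc m))) eq = ℕ.<⇒≢ (begin-strict
    4                    <⟨ ℕ.m≤m+n 5 4 ⟩
    3 ℕ.* 3              ≤⟨ ℕ.*-mono-≤ (ℕ.m≤m+n 3 m) (ℕ.m≤m+n 3 m) ⟩
    n ℕ.* n              ≤⟨ ℕ.m≤m*n (n ℕ.* n) (suc p) ⟩
    n ℕ.* n ℕ.* suc p    ∎) (sym eq)
  where open ℕ.≤-Reasoning

≃-refl : ∀ x → x ≃ x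
≃-refl x = unwrap {x} {x} (≈-pointwise λ _ → refl)

-- Elements of R(p) sending a given point to ∞.

module _ {p : ℕ} where

  -- Since √p √p = p, the determinant is the integer ad - pbc.
  ∈R-diagonal : ∀ a b c d → a ℤ.* d ≡ 1ℤ ℤ.+ (+ p ℤ.* b) ℤ.* c →
    mat (fromℤ a) (fromℤ b * √ p) (fromℤ c * √ p) (fromℤ d) ∈R⟨ p ⟩
  ∈R-diagonal a b c d eq = unwrap {det (mat (fromℤ a) (fromℤ b * √ p) (fromℤ c * √ p) (fromℤ d))} {1ℝ} det≈1 ,
    a , b , c , d , inj₁
    ( ≃-refl (fromℤ a) , ≃-refl (fromℤ b * √ p)
    , ≃-refl (fromℤ c * √ p) , ≃-refl (fromℤ d))
    where
    open +-*-Solver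
    det≈1 : fromℤ a * fromℤ d + - ((fromℤ b * √ p) * (fromℤ c * √ p)) ≈ 1ℝ
    det≈1 = ≈-by ((- (fromℤ b * fromℤ c)) ∙ √*√≈ p ⊕ 1ℝ ∙ fromℤ-det a d (+ p ℤ.* b) c eq
                  ⊕ fromℤ c ∙ fromℤ-* (+ p) b) λ n →
      solve 7 (λ a b c d s p pb →
        (a :* d :+ :- ((b :* s) :* (c :* s))) :- con 1ℚ :=
        (:- (b :* c)) :* (s :* s :- p) :+ con 1ℚ :* (a :* d :- (con 1ℚ :+ pb :* c))
          :+ c :* (pb :- p :* b)) refl
        (a ℚ./ 1) (b ℚ./ 1) (c ℚ./ 1) (d ℚ./ 1) (√-seq p n) (+ p ℚ./ 1) ((+ p ℤ.* b) ℚ./ 1)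

  ∈R-antidiagonal : ∀ a b c d → (+ p ℤ.* a) ℤ.* d ≡ 1ℤ ℤ.+ b ℤ.* c →
    mat (fromℤ a * √ p) (fromℤ b) (fromℤ c) (fromℤ d * √ p) ∈R⟨ p ⟩
  ∈R-antidiagonal a b c d eq = unwrap {det (mat (fromℤ a * √ p) (fromℤ b) (fromℤ c) (fromℤ d * √ p))} {1ℝ} det≈1 ,
    a , b , c , d , inj₂
    ( ≃-refl (fromℤ a * √ p) , ≃-refl (fromℤ b)
    , ≃-refl (fromℤ c) , ≃-refl (fromℤ d * √ p))
    where
    open +-*-Solver
    det≈1 : (fromℤ a * √ p) * (fromℤ d * √ p) + - (fromℤ b * fromℤ c) ≈ 1ℝ
    det≈1 = ≈-by ((fromℤ a * fromℤ d) ∙ √*√≈ p ⊕ 1ℝ ∙ fromℤ-det (+ p ℤ.* a) d b c eq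
                  ⊕ (- fromℤ d) ∙ fromℤ-* (+ p) a) λ n →
      solve 7 (λ a b c d s p pa →
        ((a :* s) :* (d :* s) :+ :- (b :* c)) :- con 1ℚ :=
        (a :* d) :* (s :* s :- p) :+ con 1ℚ :* (pa :* d :- (con 1ℚ :+ b :* c))
          :+ (:- d) :* (pa :- p :* a)) refl
        (a ℚ./ 1) (b ℚ./ 1) (c ℚ./ 1) (d ℚ./ 1) (√-seq p n) (+ p ℚ./ 1) ((+ p ℤ.* a) ℚ./ 1)

  -- Replaces the fraction for x √p by its reduced form. The result is stated as a vanishing
  -- difference because `fromℤ-cancel` removes the factor from a product equal to 0.
  cancel-common-factor : ∀ x g {c′ e′} c e → g ≢ 0ℤ → c′ ≡ g ℤ.* c → e′ ≡ g ℤ.* e →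
    (fromℤ c′ * √ p) * x ≈ fromℤ e′ → (fromℤ c * √ p) * x + - fromℤ e ≈ 0ℝ
  cancel-common-factor x g c e g≢0 refl refl h = fromℤ-cancel {g} {(fromℤ c * √ p) * x + - fromℤ e} g≢0
    (≈-by (1ℝ ∙ h ⊕ (- (√ p * x)) ∙ fromℤ-* g c ⊕ 1ℝ ∙ fromℤ-* g e) λ n →
      solve 7 (λ g c e s x gc ge →
        g :* ((c :* s) :* x :+ :- e) :- con 0ℚ :=
        con 1ℚ :* ((gc :* s) :* x :- ge) :+ (:- (s :* x)) :* (gc :- g :* c)
          :+ con 1ℚ :* (ge :- g :* e)) refl
        (g ℚ./ 1) (c ℚ./ 1) (e ℚ./ 1) (√-seq p n) (seq x n) ((g ℤ.* c) ℚ./ 1) ((g ℤ.* e) ℚ./ 1))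
    where open +-*-Solver

  coprime⇒equivalent-∞ : ∀ x c e u v r w → u ℤ.* c ℤ.+ v ℤ.* e ≡ 1ℤ →
    r ℤ.* + p ℤ.+ w ℤ.* e ≡ 1ℤ → (fromℤ c * √ p) * x + - fromℤ e ≈ 0ℝ → Equivalent p (fin x) ∞
  coprime⇒equivalent-∞ x c e u v r w uc+ve≡1 rp+we≡1 h =
    mat (fromℤ a) (fromℤ b * √ p) (fromℤ c * √ p) (fromℤ (ℤ.- e)) ,
    ∈R-diagonal a b c (ℤ.- e) (trans expand (cong₂ (λ i j → i ℤ.* j ℤ.+ + p ℤ.* b ℤ.* c) rp+we≡1 uc+ve≡1)) ,
    unwrap {(fromℤ c * √ p) * x + fromℤ (ℤ.- e)} {0ℝ} denominator≈0
    where
    -- Multiplying the two relations gives p c (r u) + e (r p v + w (u c + v e)) = 1, a Bézout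
    -- relation for p c and e. Its coefficients, with signs changed, are `b` and `a`.
    a b : ℤ
    a = ℤ.- (r ℤ.* + p ℤ.* v ℤ.+ w ℤ.* (u ℤ.* c ℤ.+ v ℤ.* e))
    b = ℤ.- (r ℤ.* u)
    expand : a ℤ.* ℤ.- e ≡
      (r ℤ.* + p ℤ.+ w ℤ.* e) ℤ.* (u ℤ.* c ℤ.+ v ℤ.* e) ℤ.+ + p ℤ.* b ℤ.* c
    expand = solve 7 (λ c e u v r w p →
        (:- (r :* p :* v :+ w :* (u :* c :+ v :* e))) :* (:- e) :=
        (r :* p :+ w :* e) :* (u :* c :+ v :* e) :+ p :* (:- (r :* u)) :* c) refl c e u v r w (+ p)
      where open ℤ-Solver.+-*-Solver
    denominator≈0 : (fromℤ c * √ p) * x + fromℤ (ℤ.- e) ≈ 0ℝ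
    denominator≈0 = ≈-by (1ℝ ∙ h ⊕ 1ℝ ∙ fromℤ-neg e) λ n →
      solve 5 (λ c s x e e̅ → ((c :* s) :* x :+ e̅) :- con 0ℚ :=
        con 1ℚ :* ((c :* s) :* x :+ :- e :- con 0ℚ) :+ con 1ℚ :* (e̅ :- (:- e))) refl
        (c ℚ./ 1) (√-seq p n) (seq x n) (e ℚ./ 1) ((ℤ.- e) ℚ./ 1)
      where open +-*-Solver

  divisible⇒equivalent-∞ : ∀ x c {e′} e u v → p ≢ 0 → e′ ≡ + p ℤ.* e →
    u ℤ.* c ℤ.+ v ℤ.* e′ ≡ 1ℤ → (fromℤ c * √ p) * x + - fromℤ e′ ≈ 0ℝ → Equivalent p (fin x) ∞
  divisible⇒equivalent-∞ x c e u v p≢0 refl uc+vpe≡1 h =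
    -- The determinant is p v e + u c, so the given Bézout relation already supplies the upper row.
    mat (fromℤ (ℤ.- v) * √ p) (fromℤ (ℤ.- u)) (fromℤ c) (fromℤ (ℤ.- e) * √ p) ,
    ∈R-antidiagonal (ℤ.- v) (ℤ.- u) c (ℤ.- e)
      (trans expand (cong (ℤ._+ (ℤ.- u) ℤ.* c) uc+vpe≡1)) ,
    -- The hypothesis is √p times the equation wanted. A second factor √p turns this into the
    -- integer factor p, which can be cancelled.
    unwrap {fromℤ c * x + fromℤ (ℤ.- e) * √ p} {0ℝ} (fromℤ-cancel {+ p} {fromℤ c * x + fromℤ (ℤ.- e) * √ p}
      (λ p≡0 → p≢0 (ℤ.+-injective p≡0)) p*denominator≈0)
    where
    expand : (+ p ℤ.* ℤ.- v) ℤ.* ℤ.- e ≡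
      (u ℤ.* c ℤ.+ v ℤ.* (+ p ℤ.* e)) ℤ.+ (ℤ.- u) ℤ.* c
    expand = solve 5 (λ c e u v p → (p :* (:- v)) :* (:- e) :=
        (u :* c :+ v :* (p :* e)) :+ (:- u) :* c) refl c e u v (+ p)
      where open ℤ-Solver.+-*-Solver
    p*denominator≈0 : fromℤ (+ p) * (fromℤ c * x + fromℤ (ℤ.- e) * √ p) ≈ 0ℝ
    p*denominator≈0 = ≈-by ((- (fromℤ c * x)) ∙ √*√≈ p ⊕ √ p ∙ h ⊕ √ p ∙ fromℤ-* (+ p) e
                            ⊕ (fromℤ (+ p) * √ p) ∙ fromℤ-neg e) λ n →
      solve 7 (λ c s x e e̅ p pe → p :* (c :* x :+ e̅ :* s) :- con 0ℚ :=
        (:- (c :* x)) :* (s :* s :- p) :+ s :* ((c :* s) :* x :+ :- pe :- con 0ℚ)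
          :+ s :* (pe :- p :* e) :+ (p :* s) :* (e̅ :- (:- e))) refl
        (c ℚ./ 1) (√-seq p n) (seq x n) (e ℚ./ 1) ((ℤ.- e) ℚ./ 1) (+ p ℚ./ 1) ((+ p ℤ.* e) ℚ./ 1)
      where open +-*-Solver

  reduced⇒equivalent-∞ : ∀ x c e u v → p ≢ 0 →
    (∃[ r ] ∃[ w ] r ℤ.* + p ℤ.+ w ℤ.* e ≡ 1ℤ) ⊎ (∃[ k ] e ≡ + p ℤ.* k) →
    u ℤ.* c ℤ.+ v ℤ.* e ≡ 1ℤ → (fromℤ c * √ p) * x + - fromℤ e ≈ 0ℝ → Equivalent p (fin x) ∞
  reduced⇒equivalent-∞ x c e u v p≢0 (inj₁ (r , w , rp+we≡1)) =
    λ uc+ve≡1 → coprime⇒equivalent-∞ x c e u v r w uc+ve≡1 rp+we≡1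
  reduced⇒equivalent-∞ x c e u v p≢0 (inj₂ (k , e≡pk)) =
    divisible⇒equivalent-∞ x c {e} k u v p≢0 e≡pk

  bézout⇒equivalent-∞ : Prime p → ∀ x c e → Bézout c e → (fromℤ c * √ p) * x ≈ fromℤ e →
    Equivalent p (fin x) ∞
  bézout⇒equivalent-∞ p-prime x c e
    record { g = g ; a′ = c′ ; b′ = e′ ; u = u ; v = v ; g≢0 = g≢0
           ; a≡ga′ = c≡gc′ ; b≡gb′ = e≡ge′ ; ua′+vb′≡1 = uc′+ve′≡1 } h =
    reduced⇒equivalent-∞ x c′ e′ u v (λ p≡0 → ¬prime[0] (subst Prime p≡0 p-prime))
      (prime-coprime-or-divides p-prime e′) uc′+ve′≡1
      (cancel-common-factor x g {c} {e} c′ e′ g≢0 c≡gc′ e≡ge′ h)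

  -- The hypotheses say that x √p is the rational number e/c; it is reduced to lowest terms before
  -- the split on whether p divides the numerator.
  prime⇒equivalent-∞ : Prime p → ∀ x c e → c ≢ 0ℤ → (fromℤ c * √ p) * x ≈ fromℤ e →
    Equivalent p (fin x) ∞
  prime⇒equivalent-∞ p-prime x c e c≢0 =
    bézout⇒equivalent-∞ p-prime x c e (bézout c e (λ _ → c≢0))

-- Finite fixed points of parabolic elements.

-- A parabolic element with eigenvalue t acts on the eigenvector (x , 1) by
-- u = c x + d, so the characteristic equation reads (u - t) ² = 0.
denominator≈eigenvalue : ∀ a b c d x t → a * d + - (b * c) ≈ 1ℝ → a + d ≈ t + t → t * t ≈ 1ℝ →
  x * (c * x + d) ≈ a * x + b → c * x + d ≈ t
denominator≈eigenvalue a b c d x t det tr t² fixed = ≈-by (1ℝ ∙ u-t≈0) λ n →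
    solve 4 (λ c d x t → (c :* x :+ d) :- t := con 1ℚ :* ((c :* x :+ d :+ :- t) :- con 0ℚ)) refl
      (seq c n) (seq d n) (seq x n) (seq t n)
  where
  open +-*-Solver
  u-t : ℝ
  u-t = c * x + d + - t
  square≈0 : u-t * u-t ≈ 0ℝ
  square≈0 = ≈-by (c ∙ fixed ⊕ (c * x + d) ∙ tr ⊕ (- 1ℝ) ∙ det ⊕ 1ℝ ∙ t²) λ n →
    solve 6 (λ a b c d x t →
      (c :* x :+ d :+ :- t) :* (c :* x :+ d :+ :- t) :- con 0ℚ :=
      c :* (x :* (c :* x :+ d) :- (a :* x :+ b)) :+ (c :* x :+ d) :* (a :+ d :- (t :+ t))
        :+ (:- con 1ℚ) :* (a :* d :+ :- (b :* c) :- con 1ℚ) :+ con 1ℚ :* (t :* t :- con 1ℚ)) refl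
      (seq a n) (seq b n) (seq c n) (seq d n) (seq x n) (seq t n)
  u-t≈0 : u-t ≈ 0ℝ
  u-t≈0 = x*x≈0⇒x≈0 u-t square≈0

IsScalar : Mat → ℝ → Set
IsScalar (mat a b c d) t = a ≈ t × b ≈ 0ℝ × c ≈ 0ℝ × d ≈ t

-- If c = 0, the eigenvalue equation gives d = t, the trace gives a = t, and the fixed-point
-- equation becomes t x = t x + b, so b = 0.
c≈0⇒scalar : ∀ a b c d x t → c ≈ 0ℝ → c * x + d ≈ t → a + d ≈ t + t →
  x * (c * x + d) ≈ a * x + b → IsScalar (mat a b c d) t
c≈0⇒scalar a b c d x t c≈0 u≈t tr fixed = a≈t , b≈0 , c≈0 , d≈t
  where
  open +-*-Solver
  d≈t : d ≈ t
  d≈t = ≈-by (1ℝ ∙ u≈t ⊕ (- x) ∙ c≈0) λ n →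
    solve 4 (λ c d x t → d :- t :=
      con 1ℚ :* ((c :* x :+ d) :- t) :+ (:- x) :* (c :- con 0ℚ)) refl
      (seq c n) (seq d n) (seq x n) (seq t n)
  a≈t : a ≈ t
  a≈t = ≈-by (1ℝ ∙ tr ⊕ (- 1ℝ) ∙ d≈t) λ n →
    solve 3 (λ a d t → a :- t :=
      con 1ℚ :* (a :+ d :- (t :+ t)) :+ (:- con 1ℚ) :* (d :- t)) refl
      (seq a n) (seq d n) (seq t n)
  b≈0 : b ≈ 0ℝ
  b≈0 = ≈-by ((- 1ℝ) ∙ fixed ⊕ x ∙ u≈t ⊕ (- x) ∙ a≈t) λ n →
    solve 6 (λ a b c d x t → b :- con 0ℚ :=
      (:- con 1ℚ) :* (x :* (c :* x :+ d) :- (a :* x :+ b))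
        :+ x :* (c :* x :+ d :- t) :+ (:- x) :* (a :- t)) refl
      (seq a n) (seq b n) (seq c n) (seq d n) (seq x n) (seq t n)

-- Treats traces 2 and -2 together through τ = 1 or τ = -1. An integer τ is chosen so that τ - d is
-- an integer whenever d is.
parabolic-eigenvalue : ∀ a b c d → IsParabolic (mat a b c d) →
  ∃[ τ ] (a + d ≈ fromℤ τ + fromℤ τ × fromℤ τ * fromℤ τ ≈ 1ℝ × ¬ IsScalar (mat a b c d) (fromℤ τ))
parabolic-eigenvalue a b c d (≢I , _ , inj₁ tr≃2) = 1ℤ ,
  ≈-trans {a + d} {2ℝ} (wrap tr≃2) (≈-pointwise λ _ → refl) , ≈-pointwise (λ _ → refl) ,
  λ (wrap a≃1 , wrap b≃0 , wrap c≃0 , wrap d≃1) → ≢I (a≃1 , b≃0 , c≃0 , d≃1)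
parabolic-eigenvalue a b c d (_ , ≢-I , inj₂ tr≃-2) = -1ℤ ,
  ≈-trans {a + d} { - 2ℝ} (wrap tr≃-2) (≈-pointwise λ _ → refl) , ≈-pointwise (λ _ → refl) ,
  λ (a≈-1 , wrap b≃0 , wrap c≃0 , d≈-1) →
    ≢-I (unwrap {a} { - 1ℝ} (negate a a≈-1) , b≃0 , c≃0 , unwrap {d} { - 1ℝ} (negate d d≈-1))
  where
  negate : ∀ x → x ≈ fromℤ -1ℤ → x ≈ - 1ℝ
  negate x x≈-1 = ≈-trans {x} {fromℤ -1ℤ} { - 1ℝ} x≈-1 (≈-pointwise λ _ → refl)

-- Parabolic elements in each of the two forms.

module _ {p : ℕ} (p-prime : Prime p) where

  diagonal-cusp : ∀ a b c d c′ d′ τ x → c ≈ fromℤ c′ * √ p → d ≈ fromℤ d′ →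
    c * x + d ≈ fromℤ τ → a + d ≈ fromℤ τ + fromℤ τ → ¬ IsScalar (mat a b c d) (fromℤ τ) →
    x * (c * x + d) ≈ a * x + b → Equivalent p (fin x) ∞
  diagonal-cusp a b c d c′ d′ τ x c≈c′√p d≈d′ u≈τ tr non-scalar fixed =
    prime⇒equivalent-∞ p-prime x c′ (τ ℤ.+ ℤ.- d′) c′≢0 c′√px≈τ-d′
    where
    open +-*-Solver
    c′≢0 : c′ ≢ 0ℤ
    c′≢0 c′≡0 = non-scalar (c≈0⇒scalar a b c d x (fromℤ τ) c≈0 u≈τ tr fixed)
      where
      c≈0 : c ≈ 0ℝ
      c≈0 = ≈-by (1ℝ ∙ c≈c′√p ⊕ √ p ∙ fromℤ-cong c′≡0) λ n →
        solve 3 (λ c s c′ → c :- con 0ℚ :=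
          con 1ℚ :* (c :- c′ :* s) :+ s :* (c′ :- con 0ℚ)) refl
          (seq c n) (√-seq p n) (c′ ℚ./ 1)
    c′√px≈τ-d′ : (fromℤ c′ * √ p) * x ≈ fromℤ (τ ℤ.+ ℤ.- d′)
    c′√px≈τ-d′ = ≈-by (1ℝ ∙ u≈τ ⊕ (- x) ∙ c≈c′√p ⊕ (- 1ℝ) ∙ d≈d′
                       ⊕ (- 1ℝ) ∙ fromℤ-+ τ (ℤ.- d′) ⊕ (- 1ℝ) ∙ fromℤ-neg d′) λ n →
      solve 9 (λ c d c′ d′ s x t n e → (c′ :* s) :* x :- e :=
        con 1ℚ :* (c :* x :+ d :- t) :+ (:- x) :* (c :- c′ :* s) :+ (:- con 1ℚ) :* (d :- d′)
          :+ (:- con 1ℚ) :* (e :- (t :+ n)) :+ (:- con 1ℚ) :* (n :- (:- d′))) refl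
        (seq c n) (seq d n) (c′ ℚ./ 1) (d′ ℚ./ 1) (√-seq p n) (seq x n) (τ ℚ./ 1)
        ((ℤ.- d′) ℚ./ 1) ((τ ℤ.+ ℤ.- d′) ℚ./ 1)

  -- The trace (a′ + d′) √p would satisfy (a′ + d′) ² p = 4.
  antidiagonal-not-parabolic : ∀ a d a′ d′ t → a ≈ fromℤ a′ * √ p → d ≈ fromℤ d′ * √ p →
    a + d ≈ t + t → ¬ (t * t ≈ 1ℝ)
  antidiagonal-not-parabolic a d a′ d′ t a≈a′√p d≈d′√p tr t² =
    prime∧n*n*p≢4 p-prime ℤ.∣ m ∣ (trans (sym ∣mmp∣) (cong ℤ.∣_∣ (fromℤ-injective {m ℤ.* m ℤ.* + p} {+ 4} m*m*p≈4)))
    where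
    open +-*-Solver
    m : ℤ
    m = a′ ℤ.+ d′
    ∣mmp∣ : ℤ.∣ m ℤ.* m ℤ.* + p ∣ ≡ ℤ.∣ m ∣ ℕ.* ℤ.∣ m ∣ ℕ.* p
    ∣mmp∣ = trans (ℤ.abs-* (m ℤ.* m) (+ p)) (cong (ℕ._* p) (ℤ.abs-* m m))
    m√p≈2t : fromℤ m * √ p ≈ t + t
    m√p≈2t = ≈-by (√ p ∙ fromℤ-+ a′ d′ ⊕ (- 1ℝ) ∙ a≈a′√p ⊕ (- 1ℝ) ∙ d≈d′√p ⊕ 1ℝ ∙ tr) λ n →
      solve 7 (λ a d a′ d′ s t m → m :* s :- (t :+ t) :=
        s :* (m :- (a′ :+ d′)) :+ (:- con 1ℚ) :* (a :- a′ :* s) :+ (:- con 1ℚ) :* (d :- d′ :* s)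
          :+ con 1ℚ :* (a :+ d :- (t :+ t))) refl
        (seq a n) (seq d n) (a′ ℚ./ 1) (d′ ℚ./ 1) (√-seq p n) (seq t n) (m ℚ./ 1)
    m*m*p≈4 : fromℤ (m ℤ.* m ℤ.* + p) ≈ fromℤ (+ 4)
    m*m*p≈4 = ≈-by (1ℝ ∙ fromℤ-* (m ℤ.* m) (+ p) ⊕ fromℤ (+ p) ∙ fromℤ-* m m
                    ⊕ (- (fromℤ m * fromℤ m)) ∙ √*√≈ p
                    ⊕ (fromℤ m * √ p + t + t) ∙ m√p≈2t ⊕ fromℤ (+ 4) ∙ t²) λ n →
      solve 6 (λ m p s t mm mmp → mmp :- con (+ 4 ℚ./ 1) :=
        con 1ℚ :* (mmp :- mm :* p) :+ p :* (mm :- m :* m) :+ (:- (m :* m)) :* (s :* s :- p)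
          :+ (m :* s :+ t :+ t) :* (m :* s :- (t :+ t))
          :+ con (+ 4 ℚ./ 1) :* (t :* t :- con 1ℚ)) refl
        (m ℚ./ 1) (+ p ℚ./ 1) (√-seq p n) (seq t n) ((m ℤ.* m) ℚ./ 1) ((m ℤ.* m ℤ.* + p) ℚ./ 1)

-- The point ∞ and the finite cusps.

∞-equivalent-∞ : ∀ p → Equivalent p ∞ ∞
∞-equivalent-∞ p =
  -- The identity matrix, written in the first form.
  mat (fromℤ 1ℤ) (fromℤ 0ℤ * √ p) (fromℤ 0ℤ * √ p) (fromℤ 1ℤ) ,
  ∈R-diagonal {p} 1ℤ 0ℤ 0ℤ 1ℤ (cong (λ i → 1ℤ ℤ.+ i) (sym (ℤ.*-zeroʳ (+ p ℤ.* 0ℤ)))) ,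
  unwrap {fromℤ 0ℤ * √ p} {0ℝ} (≈-pointwise λ n → ℚ.*-zeroˡ (√-seq p n))

finite-cusp : ∀ {p} → Prime p → ∀ x a b c d → mat a b c d ∈R⟨ p ⟩ →
  IsParabolic (mat a b c d) → x * (c * x + d) ≈ a * x + b → Equivalent p (fin x) ∞
finite-cusp {p} p-prime x a b c d (det≃1 , a′ , b′ , c′ , d′ , form) parabolic fixed =
  by-form (parabolic-eigenvalue a b c d parabolic) form
  where
  by-form : ∃[ τ ] (a + d ≈ fromℤ τ + fromℤ τ × fromℤ τ * fromℤ τ ≈ 1ℝ ×
                    ¬ IsScalar (mat a b c d) (fromℤ τ)) →
    (mat a b c d ≋ mat (fromℤ a′) (fromℤ b′ * √ p) (fromℤ c′ * √ p) (fromℤ d′)) ⊎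
    (mat a b c d ≋ mat (fromℤ a′ * √ p) (fromℤ b′) (fromℤ c′) (fromℤ d′ * √ p)) →
    Equivalent p (fin x) ∞
  by-form (τ , tr , τ²≈1 , non-scalar) (inj₁ (_ , _ , c≃c′√p , d≃d′)) =
    diagonal-cusp p-prime a b c d c′ d′ τ x (wrap c≃c′√p) (wrap d≃d′)
      (denominator≈eigenvalue a b c d x (fromℤ τ) (wrap det≃1) tr τ²≈1 fixed)
      tr non-scalar fixed
  by-form (τ , tr , τ²≈1 , _) (inj₂ (a≃a′√p , _ , _ , d≃d′√p)) = contradiction τ²≈1
    (antidiagonal-not-parabolic p-prime a d a′ d′ (fromℤ τ) (wrap a≃a′√p) (wrap d≃d′√p) tr)

proposition2p8 : (p : ℕ) → Prime p → (z : ℝ∪∞) → IsCusp p z → Equivalent p z ∞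
proposition2p8 p p-prime ∞ _ = ∞-equivalent-∞ p
proposition2p8 p p-prime (fin x) (mat a b c d , M∈R , parabolic , _ , fixed) =
  finite-cusp p-prime x a b c d M∈R parabolic (wrap fixed)
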